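{- Let $n \ge 5$, let $T$ be a tree with vertex set $\{1,2,\ldots,n\}$, and let $\Gamma$ be the Cayley graph of $S_n$ generated by the transpositions $(i,j)$ such that $ij$ is an edge of $T$. Then the equality $$\mathrm{dist}_{\Gamma}(I,\pi) = c(\pi)-n+\sum_{i=1}^n \mathrm{dist}_T(i,\pi(i))$$ holds for all $\pi \in S_n$ if and only if $T$ is (isomorphic to) the star $K_{1,n-1}$.
   Context: $S_n$ is the symmetric group on $\{1,\ldots,n\}$ and $I$ is its identity; the product $\pi\tau$ means apply $\tau$ first, then $\pi$. For a tree $T$ on vertex set $\{1,\ldots,n\}$ (a transposition tree), each edge $ij$ is identified with the transposition $(i,j)$, and the Cayley graph $\Gamma$ generated by $T$ is the simple undirected graph with vertex set $S_n$ in which $g$ and $h$ are adjacent iff $h = gs$ for some transposition $s$ that is an edge of $T$. $\mathrm{dist}_G(u,v)$ denotes the distance between vertices $u,v$ in a graph $G$. $c(\pi)$ is the number of cycles of $\pi$, including cycles of length 1. -}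

module Defs where

open import Level using (0ℓ)
open import Data.Empty using (⊥)
open import Data.Fin.Base using (Fin; zero; suc; inject₁; fromℕ)
open import Data.Fin.Properties using (_≟_; any?; all?)
open import Data.Fin.Permutation using (Permutation′; _⟨$⟩ʳ_; _⟨$⟩ˡ_; _≈_; _∘ₚ_; transpose; flip; id; inverseˡ; inverseʳ)
open import Data.Fin.Permutation.Transposition.List using (TranspositionList; eval; decompose; eval-decompose)
open import Data.Fin.Subset using (Subset; ⁅_⁆; ⋃)
open import Data.Bool.Properties using () renaming (_≟_ to _≟ᵇ_)
open import Data.List.Base using (List; []; _∷_; length; map; iterate; allFin; deduplicate)
open import Data.Nat.Base using (ℕ; zero; suc; _+_; _≤_; z≤n; s≤s)
open import Data.Product.Base using (∃; _×_; _,_; proj₁; proj₂)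
open import Data.Sum.Base using (_⊎_; inj₁; inj₂)
open import Data.Unit.Base using (⊤)
open import Data.Vec.Properties using (≡-dec)
open import Function.Base using (_∘_)
open import Function.Bundles using (Inverse; _⇔_)
open import Function.Definitions using (Injective)
open import Relation.Binary.Bundles using (Setoid)
open import Relation.Binary.Core using (Rel)
open import Relation.Binary.Definitions using (Decidable; Symmetric; Irreflexive; _Respects₂_)
open import Relation.Binary.PropositionalEquality using (_≡_; _≢_; refl; sym; trans; cong; resp₂; setoid; module ≡-Reasoning)
open import Relation.Nullary using (¬_; Dec; yes; no; contradiction)
open import Relation.Nullary.Decidable using (map′; _×-dec_; dec-true; dec-false)
open import Relation.Unary using () renaming (Decidable to Decidable₁)

-- The vertices form a setoid because permutations, as vertices of a
-- Cayley graph, have to be compared pointwise.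

record Graph : Set₁ where
  field
    vertices   : Setoid 0ℓ 0ℓ
  open Setoid vertices public using () renaming (Carrier to Vertex; _≈_ to _≈ᵛ_)
  field
    Adj        : Rel Vertex 0ℓ
    adj-resp   : Adj Respects₂ _≈ᵛ_
    adj-sym    : Symmetric Adj
    adj-irrefl : Irreflexive _≈ᵛ_ Adj

record _≅_ (G H : Graph) : Set where
  private
    module G = Graph G
    module H = Graph H
  field
    bijection : Inverse G.vertices H.vertices
  open Inverse bijection public using (to)
  field
    adj⇔adj   : ∀ u v → G.Adj u v ⇔ H.Adj (to u) (to v)

completeBipartite : ℕ → ℕ → Graph
completeBipartite a b = record
  { vertices   = setoid (Fin a ⊎ Fin b)
  ; Adj        = Across
  ; adj-resp   = resp₂ Across
  ; adj-sym    = λ {u} {v} → across-sym u v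
  ; adj-irrefl = λ {u} → λ { refl → across-irrefl u }
  }
  where
  Across : Rel (Fin a ⊎ Fin b) 0ℓ
  Across (inj₁ _) (inj₂ _) = ⊤
  Across (inj₂ _) (inj₁ _) = ⊤
  Across (inj₁ _) (inj₁ _) = ⊥
  Across (inj₂ _) (inj₂ _) = ⊥

  across-sym : ∀ u v → Across u v → Across v u
  across-sym (inj₁ _) (inj₂ _) e = e
  across-sym (inj₂ _) (inj₁ _) e = e

  across-irrefl : ∀ u → ¬ Across u u
  across-irrefl (inj₁ _) ()
  across-irrefl (inj₂ _) ()

module _ (G : Graph) where
  open Graph G
  private module V = Setoid vertices

  data Walk : Vertex → Vertex → ℕ → Set where
    stop : ∀ {u v} → u ≈ᵛ v → Walk u v 0
    step : ∀ {u v w k} → Adj u v → Walk v w k → Walk u w (suc k)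

  Connected : Set
  Connected = ∀ u v → ∃ (Walk u v)

  -- c 0, …, c (m + 2) are the distinct vertices of a cycle of length m + 3.
  IsCycle : ∀ {m} → (Fin (3 + m) → Vertex) → Set
  IsCycle {m} c =
    Injective _≡_ _≈ᵛ_ c ×
    (∀ (i : Fin (2 + m)) → Adj (c (inject₁ i)) (c (suc i))) ×
    Adj (c (fromℕ (2 + m))) (c zero)

  Acyclic : Set
  Acyclic = ∀ {m} (c : Fin (3 + m) → Vertex) → ¬ IsCycle c

  IsDistance : Vertex → Vertex → ℕ → Set
  IsDistance u v d = Walk u v d × (∀ k → Walk u v k → d ≤ k)

  walk-respˡ : ∀ {u u′ v k} → u ≈ᵛ u′ → Walk u v k → Walk u′ v k
  walk-respˡ u≈u′ (stop u≈v)  = stop (V.trans (V.sym u≈u′) u≈v)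
  walk-respˡ u≈u′ (step e ws) = step (proj₂ adj-resp u≈u′ e) ws

  walk-respʳ : ∀ {u v v′ k} → v ≈ᵛ v′ → Walk u v k → Walk u v′ k
  walk-respʳ v≈v′ (stop u≈v)  = stop (V.trans u≈v v≈v′)
  walk-respʳ v≈v′ (step e ws) = step e (walk-respʳ v≈v′ ws)

  walk-++ : ∀ {u v w k l} → Walk u v k → Walk v w l → Walk u w (k + l)
  walk-++ (stop u≈v)  xs = walk-respˡ (V.sym u≈v) xs
  walk-++ (step e ws) xs = step e (walk-++ ws xs)

least : ∀ {P : ℕ → Set} → Decidable₁ P → ∀ n → P n →
        ∃ λ m → P m × (∀ k → P k → m ≤ k)
least P? zero    p = 0 , p , λ _ _ → z≤n
least P? (suc n) p with P? 0
... | yes p₀ = 0 , p₀ , λ _ _ → z≤n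
... | no ¬p₀ with least (P? ∘ suc) n p
...   | m , pm , m≤ = suc m , pm ,
        λ { zero p₀ → contradiction p₀ ¬p₀ ; (suc k) pk → s≤s (m≤ k pk) }

-- Constructively, minimising over the lengths of walks requires being
-- able to decide whether a walk of a given length exists.

record HasDistances (G : Graph) : Set where
  open Graph G
  field
    walk?     : ∀ u v k → Dec (Walk G u v k)
    connected : Connected G

  distance : ∀ u v → ∃ (IsDistance G u v)
  distance u v = least (walk? u v) _ (proj₂ (connected u v))

  dist : Vertex → Vertex → ℕ
  dist u v = proj₁ (distance u v)

-- Decidability of adjacency makes the edge set a genuine subset of the
-- finite set of pairs of vertices.

record Tree (n : ℕ) : Set₁ where
  field
    Edge        : Rel (Fin n) 0ℓ
    edge?       : Decidable Edge
    edge-sym    : Symmetric Edge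
    edge-irrefl : Irreflexive _≡_ Edge

  graph : Graph
  graph = record
    { vertices   = setoid (Fin n)
    ; Adj        = Edge
    ; adj-resp   = resp₂ Edge
    ; adj-sym    = edge-sym
    ; adj-irrefl = edge-irrefl
    }

  field
    connected : Connected graph
    acyclic   : Acyclic graph

  walk? : ∀ i j k → Dec (Walk graph i j k)
  walk? i j zero    = map′ stop (λ { (stop p) → p }) (i ≟ j)
  walk? i j (suc k) =
    map′ (λ { (_ , e , w) → step e w }) (λ { (step e w) → _ , e , w })
         (any? λ l → edge? i l ×-dec walk? l j k)

  hasDistances : HasDistances graph
  hasDistances = record { walk? = walk? ; connected = connected }

  dist : Fin n → Fin n → ℕ
  dist = HasDistances.dist hasDistances

module _ {n : ℕ} where

  transpose-left : ∀ (i j : Fin n) → transpose i j ⟨$⟩ʳ i ≡ j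
  transpose-left i j rewrite dec-true (i ≟ i) refl = refl

  transpose-right : ∀ (i j : Fin n) → transpose i j ⟨$⟩ʳ j ≡ i
  transpose-right i j with j ≟ i
  ... | yes j≡i = j≡i
  ... | no  _ rewrite dec-true (j ≟ j) refl = refl

  transpose-other : ∀ {i j x : Fin n} → x ≢ i → x ≢ j → transpose i j ⟨$⟩ʳ x ≡ x
  transpose-other {i} {j} {x} x≢i x≢j
    rewrite dec-false (x ≟ i) x≢i | dec-false (x ≟ j) x≢j = refl

  transpose-refl : ∀ (i : Fin n) → transpose i i ≈ id
  transpose-refl i x with x ≟ i
  ... | yes x≡i = sym x≡i
  ... | no  x≢i rewrite dec-false (x ≟ i) x≢i = refl

  transpose-involutive : ∀ (i j : Fin n) → transpose i j ∘ₚ transpose i j ≈ id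
  transpose-involutive i j x = go (x ≟ i) (x ≟ j)
    where
    t = transpose i j ⟨$⟩ʳ_
    go : Dec (x ≡ i) → Dec (x ≡ j) → t (t x) ≡ x
    go (yes refl) _          = trans (cong t (transpose-left i j)) (transpose-right i j)
    go (no _)     (yes refl) = trans (cong t (transpose-right i j)) (transpose-left i j)
    go (no x≢i)   (no x≢j)   = trans (cong t (transpose-other x≢i x≢j)) (transpose-other x≢i x≢j)

  transpose-conjugate : ∀ {i j k : Fin n} → i ≢ j → i ≢ k → k ≢ j →
    transpose i k ∘ₚ transpose k j ∘ₚ transpose i k ≈ transpose i j
  transpose-conjugate {i} {j} {k} i≢j i≢k k≢j x = go (x ≟ i) (x ≟ j) (x ≟ k)
    where
    s = transpose i k ⟨$⟩ʳ_
    t = transpose k j ⟨$⟩ʳ_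
    u = transpose i j ⟨$⟩ʳ_

    chain : ∀ {a b c} → s x ≡ a → t a ≡ b → s b ≡ c → u x ≡ c → s (t (s x)) ≡ u x
    chain refl refl refl q = sym q

    go : Dec (x ≡ i) → Dec (x ≡ j) → Dec (x ≡ k) → s (t (s x)) ≡ u x
    go (yes refl) _ _ =
      chain (transpose-left i k) (transpose-left k j)
            (transpose-other (i≢j ∘ sym) (k≢j ∘ sym)) (transpose-left i j)
    go (no _) (yes refl) _ =
      chain (transpose-other (i≢j ∘ sym) (k≢j ∘ sym)) (transpose-right k j)
            (transpose-right i k) (transpose-right i j)
    go (no _) (no _) (yes refl) =
      chain (transpose-right i k) (transpose-other i≢k i≢j)
            (transpose-left i k) (transpose-other (i≢k ∘ sym) k≢j)
    go (no x≢i) (no x≢j) (no x≢k) =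
      chain (transpose-other x≢i x≢k) (transpose-other x≢k x≢j)
            (transpose-other x≢i x≢k) (transpose-other x≢i x≢j)

permutations : ℕ → Setoid 0ℓ 0ℓ
permutations n = record
  { Carrier       = Permutation′ n
  ; _≈_           = _≈_
  ; isEquivalence = record
    { refl  = λ _ → refl
    ; sym   = λ p i → sym (p i)
    ; trans = λ p q i → trans (p i) (q i)
    }
  }

module _ {n : ℕ} (T : Tree n) where
  open Tree T using (Edge; edge?; edge-irrefl)

  -- π ∘ₚ ρ applies π first, so transpose i j ∘ₚ g is the product g(i,j)
  -- in which the transposition is applied first.
  cayley : Graph
  cayley = record
    { vertices   = permutations n
    ; Adj        = CayleyAdj
    ; adj-resp   =
        (λ { h≈h′ (i , j , e , h≈) → i , j , e , λ x → trans (sym (h≈h′ x)) (h≈ x) })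
      , (λ { g≈g′ (i , j , e , h≈) → i , j , e , λ x → trans (h≈ x) (g≈g′ _) })
    ; adj-sym    = λ {g} {h} → cayley-sym g h
    ; adj-irrefl = λ {g} {h} → cayley-irrefl g h
    }
    where
    CayleyAdj : Rel (Permutation′ n) 0ℓ
    CayleyAdj g h = ∃ λ i → ∃ λ j → Edge i j × h ≈ transpose i j ∘ₚ g

    cayley-sym : ∀ g h → CayleyAdj g h → CayleyAdj h g
    cayley-sym g h (i , j , e , h≈) = i , j , e , λ x →
      trans (sym (cong (g ⟨$⟩ʳ_) (transpose-involutive i j x))) (sym (h≈ _))

    cayley-irrefl : ∀ g h → g ≈ h → ¬ CayleyAdj g h
    cayley-irrefl g h g≈h (i , j , e , h≈) = edge-irrefl i≡j e
      where
      open ≡-Reasoning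
      i≡j : i ≡ j
      i≡j = begin
        i                                       ≡⟨ inverseˡ g ⟨
        g ⟨$⟩ˡ (g ⟨$⟩ʳ i)                       ≡⟨ cong (g ⟨$⟩ˡ_) (trans (g≈h i) (h≈ i)) ⟩
        g ⟨$⟩ˡ (g ⟨$⟩ʳ (transpose i j ⟨$⟩ʳ i))  ≡⟨ inverseˡ g ⟩
        transpose i j ⟨$⟩ʳ i                    ≡⟨ transpose-left i j ⟩
        j                                       ∎

  cayley-walk? : ∀ g h k → Dec (Walk cayley g h k)
  cayley-walk? g h zero    = map′ stop (λ { (stop p) → p }) (all? λ x → (g ⟨$⟩ʳ x) ≟ (h ⟨$⟩ʳ x))
  cayley-walk? g h (suc k) =
    map′ (λ { (i , j , e , w) → step (i , j , e , λ _ → refl) w })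
         (λ { (step (i , j , e , v≈) w) → i , j , e , walk-respˡ cayley v≈ w })
         (any? λ i → any? λ j → edge? i j ×-dec cayley-walk? (transpose i j ∘ₚ g) h k)

  reach-transpose : ∀ {i j k} → Walk (Tree.graph T) i j k → ∀ g →
                    ∃ (Walk cayley g (transpose i j ∘ₚ g))
  reach-transpose {i} (stop refl) g =
    0 , stop (λ x → cong (g ⟨$⟩ʳ_) (sym (transpose-refl i x)))
  reach-transpose {i} {j} (step {v = k} e w) g with i ≟ j | k ≟ j
  ... | yes refl | _        =
    0 , stop (λ x → cong (g ⟨$⟩ʳ_) (sym (transpose-refl i x)))
  ... | no _     | yes refl = 1 , step {v = transpose i k ∘ₚ g} (i , k , e , λ _ → refl) (stop λ _ → refl)
  ... | no i≢j   | no k≢j   =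
    _ , step (i , k , e , λ _ → refl)
             (walk-++ cayley (proj₂ (reach-transpose w (transpose i k ∘ₚ g)))
               (step {v = transpose i k ∘ₚ transpose k j ∘ₚ transpose i k ∘ₚ g} (i , k , e , λ _ → refl)
                 (stop λ x → cong (g ⟨$⟩ʳ_)
                   (transpose-conjugate i≢j (λ i≡k → edge-irrefl i≡k e) k≢j x))))

  reach-eval : ∀ (ts : TranspositionList n) g → ∃ (Walk cayley g (eval ts ∘ₚ g))
  reach-eval []             g = 0 , stop (λ _ → refl)
  reach-eval ((i , j) ∷ ts) g =
    _ , walk-++ cayley (proj₂ (reach-eval ts g))
          (proj₂ (reach-transpose (proj₂ (Tree.connected T i j)) (eval ts ∘ₚ g)))

  cayley-connected : Connected cayley
  cayley-connected g h =
    _ , walk-respʳ cayley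
          (λ x → trans (cong (g ⟨$⟩ʳ_) (eval-decompose (h ∘ₚ flip g) x)) (inverseʳ g))
          (proj₂ (reach-eval (decompose (h ∘ₚ flip g)) g))

  cayley-hasDistances : HasDistances cayley
  cayley-hasDistances = record { walk? = cayley-walk? ; connected = cayley-connected }

  cayleyDist : Permutation′ n → Permutation′ n → ℕ
  cayleyDist = HasDistances.dist cayley-hasDistances

module _ {n : ℕ} (π : Permutation′ n) where

  -- The support {i, π(i), …, πⁿ⁻¹(i)} of the cycle through i.
  cycleThrough : Fin n → Subset n
  cycleThrough i = ⋃ (map ⁅_⁆ (iterate (π ⟨$⟩ʳ_) i n))

  -- Distinct cycles of π, including those of length 1, have distinct
  -- supports, so listing the supports without repetition lists the cycles.
  cycles : List (Subset n)
  cycles = deduplicate (≡-dec _≟ᵇ_) (map cycleThrough (allFin n))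

  cycleCount : ℕ
  cycleCount = length cycles

{-# OPTIONS --safe #-}

-- Write S(π) = Σ dist(i, π(i)).  Multiplying by a transposition changes c by at most 1.
--
-- If T is not a star it contains an induced path a − b − c − d.  For π = (a c)(b d) we have
-- c(π) ≥ n − 2 and S(π) ≥ 8, so the formula predicts at least 6, while
-- π = (b c)(a b)(c d)(b c) has length at most 4.
--
-- If T is a star with centre c, then dist(j, x) − dist(c, x) = 1 − 2[x = j] for every leaf j, so
-- passing from g to g(c j) changes S by 2[g(j) = j] − 2[g(c) = j].  When j or c is fixed by g the
-- transposition merges two cycles.  Hence c + S changes by at most 1 along every edge of Γ, and
-- from every π ≠ I some edge lowers it by 1: (c π(c)) if π moves c, and (c j) for any
-- moved j otherwise.
module Submission where

open import Defs
open import Data.Nat.Properties using (+-0-commutativeMonoid)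
open import Algebra.Properties.CommutativeMonoid.Sum +-0-commutativeMonoid
  using (sum; sum-syntax; sum-cong-≗; sum-replicate-zero)
open import Data.Bool.Properties using () renaming (_≟_ to _≟ᵇ_)
open import Data.Fin.Base using (Fin; zero; suc; inject₁; punchIn; punchOut; toℕ)
open import Data.Fin.Permutation using (Permutation′; _⟨$⟩ʳ_; _∘ₚ_; id; _≈_; transpose)
open import Data.Fin.Permutation.Components using (transpose-inverse)
open import Data.Fin.Properties
  using (_≟_; all?; any?; ¬∀⟶∃¬; pigeonhole; punchIn-punchOut; punchInᵢ≢i; punchOut-cong;
         punchOut-punchIn; suc-injective; toℕ≤pred[n])
open import Data.Fin.Subset using (Subset; ⁅_⁆; ⋃) renaming (_∈_ to _∈ˢ_)
open import Data.Fin.Subset.Properties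
  using (⊆-antisym; ∉⊥; x∈⁅x⁆; x∈⁅y⁆⇒x≡y; x∈p∪q⁺; x∈p∪q⁻; _∈?_)
open import Data.Integer using (+_; _+_; _-_)
import Data.Integer.Properties as ℤ
import Data.Integer.Tactic.RingSolver as ℤ-Solver
open import Data.List.Base using (List; []; _∷_; length; map; allFin; filter; deduplicate)
import Data.List.Base as List
open import Data.List.Membership.Propositional using (_∈_; lose)
open import Data.List.Membership.Propositional.Properties
  using (∈-allFin; ∈-deduplicate⁺; ∈-deduplicate⁻; ∈-filter⁺; ∈-map⁺; ∈-map⁻)
open import Data.List.Properties
  using (filter-notAll; length-map; length-tabulate; map-cong; map-cong-local)
open import Data.List.Relation.Binary.Subset.Propositional using (_⊆_)
open import Data.List.Relation.Unary.All using ([]; _∷_)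
import Data.List.Relation.Unary.All as All
open import Data.List.Relation.Unary.AllPairs using ([]; _∷_)
open import Data.List.Relation.Unary.Any using (here; there)
open import Data.List.Relation.Unary.Unique.Propositional using (Unique)
open import Data.List.Relation.Unary.Unique.Propositional.Properties using (map⁺; allFin⁺)
import Data.List.Relation.Unary.Unique.DecPropositional.Properties as DecUnique
open import Data.Nat using (ℕ; _≤_; _∸_)
open import Data.Nat.Base as ℕ using (zero; suc; _<_; z≤n; s≤s)
open import Data.Nat.GeneralisedArithmetic using (iterate)
import Data.Nat.ListAction as ListAction
import Data.Nat.Properties as ℕ
import Data.Nat.Tactic.RingSolver as ℕ-Solver
open import Data.Product.Base using (∃; ∃₂; _×_; _,_; proj₁; proj₂)
open import Data.Sum.Base using (_⊎_; inj₁; inj₂)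
open import Data.Unit.Base using (tt)
open import Data.Vec.Functional using (updateAt)
open import Data.Vec.Functional.Properties using (updateAt-updates; updateAt-minimal)
open import Data.Vec.Properties using (≡-dec)
open import Function.Base using (_∘_; case_of_; const)
open import Function.Bundles using (_⇔_; mk⇔; Equivalence; Injection; Inverse)
open import Function.Definitions using (Injective)
open import Function.Properties.Inverse using (↔⇒↣)
open import Relation.Binary.Bundles using (Setoid)
open import Relation.Binary.Definitions using (DecidableEquality; _Respects_)
open import Relation.Binary.PropositionalEquality
  using (_≡_; _≢_; refl; sym; trans; cong; cong₂; subst; subst₂; module ≡-Reasoning)
open import Relation.Nullary using (¬_; Dec; yes; no; contradiction)
open import Relation.Nullary.Decidable using (¬?; _⊎-dec_)

private
  variable
    n : ℕ

⟨$⟩ʳ-injective : ∀ (π : Permutation′ n) {x y} → π ⟨$⟩ʳ x ≡ π ⟨$⟩ʳ y → x ≡ y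
⟨$⟩ʳ-injective π = Injection.injective (↔⇒↣ π)

-- Comparing lengths of lists without repetition.

module _ {A : Set} (_≟ᴬ_ : DecidableEquality A) where

  without : A → List A → List A
  without x = filter (λ y → ¬? (y ≟ᴬ x))

  length-without : ∀ {x ys} → x ∈ ys → length (without x ys) < length ys
  length-without {x} {ys} x∈ys = filter-notAll _ ys (lose x∈ys (λ x≢x → x≢x refl))

  ∈-without : ∀ {x y ys} → y ∈ ys → y ≢ x → y ∈ without x ys
  ∈-without = ∈-filter⁺ _

  -- Deleting the head `x` from `ys` shortens `ys`, and the tail of `xs` survives the deletion
  -- because `x` does not recur in it. The inequalities between cycle counts rest on this.
  unique-⊆⇒length-≤ : ∀ {xs ys} → Unique xs → xs ⊆ ys → length xs ≤ length ys
  unique-⊆⇒length-≤ {[]}     {ys} _          _     = z≤n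
  unique-⊆⇒length-≤ {x ∷ xs} {ys} (x∉ ∷ uxs) xs⊆ys = ℕ.≤-trans
    (s≤s (unique-⊆⇒length-≤ uxs λ y∈xs →
      ∈-without (xs⊆ys (there y∈xs)) (All.lookup x∉ y∈xs ∘ sym)))
    (length-without (xs⊆ys (here refl)))

-- Orbits and cycle supports of a permutation.

iterate-+ : ∀ {A : Set} (f : A → A) x a b →
            iterate f x (a ℕ.+ b) ≡ iterate f (iterate f x a) b
iterate-+ f x zero    b = refl
iterate-+ f x (suc a) b = iterate-+ f (f x) a b

iterate-injective : ∀ {A : Set} {f : A → A} → (∀ {x y} → f x ≡ f y → x ≡ y) →
                    ∀ k {x y} → iterate f x k ≡ iterate f y k → x ≡ y
iterate-injective inj zero    eq = eq
iterate-injective inj (suc k) eq = inj (iterate-injective inj k eq)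

∈-iterate⁺ : ∀ {A : Set} (f : A → A) x {n k} → k < n → iterate f x k ∈ List.iterate f x n
∈-iterate⁺ f x {suc n} {zero}  _         = here refl
∈-iterate⁺ f x {suc n} {suc k} (s≤s k<n) = there (∈-iterate⁺ f (f x) k<n)

∈-iterate⁻ : ∀ {A : Set} (f : A → A) x n {y} → y ∈ List.iterate f x n → ∃ λ k → iterate f x k ≡ y
∈-iterate⁻ f x (suc n) (here refl) = 0 , refl
∈-iterate⁻ f x (suc n) (there y∈)  with ∈-iterate⁻ f (f x) n y∈
... | k , eq = suc k , eq

∈-⋃-singletons⁺ : ∀ {x : Fin n} {xs} → x ∈ xs → x ∈ˢ ⋃ (map ⁅_⁆ xs)
∈-⋃-singletons⁺ (here refl) = x∈p∪q⁺ (inj₁ (x∈⁅x⁆ _))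
∈-⋃-singletons⁺ (there x∈)  = x∈p∪q⁺ (inj₂ (∈-⋃-singletons⁺ x∈))

∈-⋃-singletons⁻ : ∀ {x : Fin n} xs → x ∈ˢ ⋃ (map ⁅_⁆ xs) → x ∈ xs
∈-⋃-singletons⁻ []       x∈ = contradiction x∈ ∉⊥
∈-⋃-singletons⁻ (y ∷ xs) x∈ with x∈p∪q⁻ ⁅ y ⁆ _ x∈
... | inj₁ x∈y  = here (x∈⁅y⁆⇒x≡y y x∈y)
... | inj₂ x∈xs = there (∈-⋃-singletons⁻ xs x∈xs)

_≟ˢ_ : DecidableEquality (Subset n)
_≟ˢ_ = ≡-dec _≟ᵇ_

module _ (π : Permutation′ n) where

  private
    f = π ⟨$⟩ʳ_

  Reaches : Fin n → Fin n → Set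
  Reaches x y = ∃ λ k → iterate f x k ≡ y

  reaches-trans : ∀ {x y z} → Reaches x y → Reaches y z → Reaches x z
  reaches-trans {x} (k , refl) (l , eq) = k ℕ.+ l , trans (iterate-+ f x k l) eq

  -- Two of the iterates with exponents 0, ..., `n` coincide by the pigeonhole principle, and
  -- injectivity cancels the smaller exponent.
  reaches-return : ∀ x → ∃ λ d → d < n × iterate f x (suc d) ≡ x
  reaches-return x with pigeonhole (ℕ.n<1+n n) (iterate f x ∘ toℕ)
  ... | a , b , a<b , eq with ℕ.m≤n⇒∃[o]m+o≡n a<b
  ...   | d , a+d≡b = d , d<n , sym (iterate-injective (⟨$⟩ʳ-injective π) (toℕ a) (begin
    iterate f x (toℕ a)                        ≡⟨ eq ⟩
    iterate f x (toℕ b)                        ≡⟨ cong (iterate f x) d+a≡b ⟨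
    iterate f x (suc d ℕ.+ toℕ a)              ≡⟨ iterate-+ f x (suc d) (toℕ a) ⟩
    iterate f (iterate f x (suc d)) (toℕ a)    ∎))
    where
    open ≡-Reasoning
    d+a≡b : suc d ℕ.+ toℕ a ≡ toℕ b
    d+a≡b = trans (cong suc (ℕ.+-comm d (toℕ a))) a+d≡b
    d<n : d < n
    d<n = ℕ.≤-trans (subst (suc d ≤_) d+a≡b (ℕ.m≤m+n (suc d) (toℕ a))) (toℕ≤pred[n] b)

  -- If `y` is the `k`-th iterate of `f x`, then `y` reaches `f x` by induction, and `f x` returns
  -- to `x` along its cycle.
  reaches-sym : ∀ {x y} → Reaches x y → Reaches y x
  reaches-sym         (zero  , refl) = 0 , refl
  reaches-sym {x} {y} (suc k , eq)   =
    reaches-trans (reaches-sym (k , eq)) (proj₁ (reaches-return x) , proj₂ (proj₂ (reaches-return x)))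

  -- `cycleThrough` lists only the exponents below `n`, so membership in it requires this bound. An
  -- exponent that has grown to `n` is lowered by a return time.
  reaches-within-n : ∀ {x y} → Reaches x y → ∃ λ k → k < n × iterate f x k ≡ y
  reaches-within-n {x} (zero  , refl) = 0 , ℕ.≤-trans (s≤s z≤n) (proj₁ (proj₂ (reaches-return x))) , refl
  reaches-within-n {x} {y} (suc l , eq) with reaches-within-n (l , eq)
  ... | k , k<n , fᵏ⁺¹x≡y with ℕ.m≤n⇒m<n∨m≡n k<n
  ...   | inj₁ k+1<n = suc k , k+1<n , fᵏ⁺¹x≡y
  ...   | inj₂ k+1≡n with reaches-return x
  ...     | d , d<n , fᵈ⁺¹x≡x with ℕ.m≤n⇒∃[o]m+o≡n d<n
  -- `o` is `n − (d + 1)`: one full return to `x` is dropped from the exponent `k + 1 = n`.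
  ...       | o , d+o≡n = o , subst (o <_) d+o≡n (s≤s (ℕ.m≤n+m o d)) , (begin
    iterate f x o                      ≡⟨ cong (λ z → iterate f z o) fᵈ⁺¹x≡x ⟨
    iterate f (iterate f x (suc d)) o  ≡⟨ iterate-+ f x (suc d) o ⟨
    iterate f x (suc d ℕ.+ o)          ≡⟨ cong (iterate f x) (trans d+o≡n (sym k+1≡n)) ⟩
    iterate f x (suc k)                ≡⟨ fᵏ⁺¹x≡y ⟩
    y                                  ∎)
    where open ≡-Reasoning

  ∈-cycleThrough⁺ : ∀ {x y} → Reaches x y → y ∈ˢ cycleThrough π x
  ∈-cycleThrough⁺ {x} r with reaches-within-n r
  ... | _ , k<n , refl = ∈-⋃-singletons⁺ (∈-iterate⁺ f x k<n)

  ∈-cycleThrough⁻ : ∀ {x y} → y ∈ˢ cycleThrough π x → Reaches x y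
  ∈-cycleThrough⁻ {x} y∈ = ∈-iterate⁻ f x n (∈-⋃-singletons⁻ (List.iterate f x n) y∈)

  cycleThrough-self : ∀ x → x ∈ˢ cycleThrough π x
  cycleThrough-self x = ∈-cycleThrough⁺ (0 , refl)

  cycleThrough-≡ : ∀ {x y} → y ∈ˢ cycleThrough π x → cycleThrough π x ≡ cycleThrough π y
  cycleThrough-≡ y∈ = ⊆-antisym
    (λ z∈ → ∈-cycleThrough⁺ (reaches-trans (reaches-sym (∈-cycleThrough⁻ y∈)) (∈-cycleThrough⁻ z∈)))
    (λ z∈ → ∈-cycleThrough⁺ (reaches-trans (∈-cycleThrough⁻ y∈) (∈-cycleThrough⁻ z∈)))

  cycleThrough-fixed : ∀ {x y} → f x ≡ x → y ∈ˢ cycleThrough π x → y ≡ x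
  cycleThrough-fixed {x} fx≡x y∈ with ∈-cycleThrough⁻ y∈
  ... | k , refl = stays k
    where
    stays : ∀ k → iterate f x k ≡ x
    stays zero    = refl
    stays (suc k) = trans (cong (λ z → iterate f z k) fx≡x) (stays k)

  ∈-cycles⁺ : ∀ x → cycleThrough π x ∈ cycles π
  ∈-cycles⁺ x = ∈-deduplicate⁺ _≟ˢ_ (∈-map⁺ (cycleThrough π) (∈-allFin x))

  ∈-cycles⁻ : ∀ {S} → S ∈ cycles π → ∃ λ x → S ≡ cycleThrough π x
  ∈-cycles⁻ S∈ with ∈-map⁻ (cycleThrough π) (∈-deduplicate⁻ _≟ˢ_ (map (cycleThrough π) (allFin n)) S∈)
  ... | x , _ , eq = x , eq

  cycles-unique : Unique (cycles π)
  cycles-unique = DecUnique.deduplicate-! _≟ˢ_ _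

-- Cycle counts and their change under a transposition.

list-iterate-cong : ∀ {A : Set} {f g : A → A} → (∀ x → f x ≡ g x) → ∀ x n →
                    List.iterate f x n ≡ List.iterate g x n
list-iterate-cong         f≗g x zero    = refl
list-iterate-cong {g = g} f≗g x (suc n) = cong (x ∷_)
  (trans (list-iterate-cong f≗g _ n) (cong (λ y → List.iterate g y n) (f≗g x)))

cycleCount-cong : ∀ (g h : Permutation′ n) → g ≈ h → cycleCount g ≡ cycleCount h
cycleCount-cong {n} g h g≈h = cong (length ∘ deduplicate _≟ˢ_)
  (map-cong (λ x → cong (⋃ ∘ map ⁅_⁆) (list-iterate-cong g≈h x n)) (allFin n))

-- The supports for `id` are distinct singletons, so the list that `cycles` deduplicates is already
-- free of repetition and has length `n`.
cycleCount-id : cycleCount (id {n}) ≡ n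
cycleCount-id {n} = ℕ.≤-antisym
  (subst (cycleCount (id {n}) ≤_) length-cyclesThrough
    (unique-⊆⇒length-≤ _≟ˢ_ (cycles-unique id) (∈-deduplicate⁻ _≟ˢ_ (map (cycleThrough id) (allFin n)))))
  (subst (_≤ cycleCount (id {n})) length-cyclesThrough
    (unique-⊆⇒length-≤ _≟ˢ_ (map⁺ cycleThrough-injective (allFin⁺ n)) (∈-deduplicate⁺ _≟ˢ_)))
  where
  length-cyclesThrough : length (map (cycleThrough (id {n})) (allFin n)) ≡ n
  length-cyclesThrough = trans (length-map _ (allFin n)) (length-tabulate {n = n} _)

  cycleThrough-injective : ∀ {x y} → cycleThrough (id {n}) x ≡ cycleThrough id y → x ≡ y
  cycleThrough-injective {x} eq =
    cycleThrough-fixed id refl (subst (x ∈ˢ_) eq (cycleThrough-self id x))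

-- h is g times the transposition (i j), stated so as to be symmetric in i and j and in g and h.
record Swapped (i j : Fin n) (g h : Permutation′ n) : Set where
  field
    at-i  : h ⟨$⟩ʳ i ≡ g ⟨$⟩ʳ j
    at-j  : h ⟨$⟩ʳ j ≡ g ⟨$⟩ʳ i
    agree : ∀ {x} → x ≢ i → x ≢ j → h ⟨$⟩ʳ x ≡ g ⟨$⟩ʳ x

swapped-comm : ∀ {i j} {g h : Permutation′ n} → Swapped i j g h → Swapped j i g h
swapped-comm sw = record { at-i = at-j ; at-j = at-i ; agree = λ x≢j x≢i → agree x≢i x≢j }
  where open Swapped sw

swapped-sym : ∀ {i j} {g h : Permutation′ n} → Swapped i j g h → Swapped i j h g
swapped-sym sw = record
  { at-i = sym at-j ; at-j = sym at-i ; agree = λ x≢i x≢j → sym (agree x≢i x≢j) }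
  where open Swapped sw

≈⇒swapped : ∀ i j (g h : Permutation′ n) → h ≈ transpose i j ∘ₚ g → Swapped i j g h
≈⇒swapped i j g h h≈ = record
  { at-i  = trans (h≈ i) (cong (g ⟨$⟩ʳ_) (transpose-left i j))
  ; at-j  = trans (h≈ j) (cong (g ⟨$⟩ʳ_) (transpose-right i j))
  ; agree = λ x≢i x≢j → trans (h≈ _) (cong (g ⟨$⟩ʳ_) (transpose-other x≢i x≢j))
  }

transpose-swapped : ∀ i j (g : Permutation′ n) → Swapped i j g (transpose i j ∘ₚ g)
transpose-swapped i j g = ≈⇒swapped i j g (transpose i j ∘ₚ g) λ _ → refl

module _ {i j : Fin n} {g h : Permutation′ n} (sw : Swapped i j g h) where

  open Swapped sw

  -- The orbit of `x` under `h` never meets `i` or `j`, the only points where `g` and `h` can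
  -- differ.
  iterate-agree : ∀ {x} → ¬ Reaches h x i → ¬ Reaches h x j → ∀ k →
                  iterate (h ⟨$⟩ʳ_) x k ≡ iterate (g ⟨$⟩ʳ_) x k
  iterate-agree ¬i ¬j zero = refl
  iterate-agree {x} ¬i ¬j (suc k) = trans
    (iterate-agree (λ { (l , eq) → ¬i (suc l , eq) }) (λ { (l , eq) → ¬j (suc l , eq) }) k)
    (cong (λ z → iterate (g ⟨$⟩ʳ_) z k)
      (agree (λ x≡i → ¬i (0 , x≡i)) (λ x≡j → ¬j (0 , x≡j))))

  cycleThrough-agree : ∀ {x} → ¬ (i ∈ˢ cycleThrough h x) → ¬ (j ∈ˢ cycleThrough h x) →
                       cycleThrough h x ≡ cycleThrough g x
  cycleThrough-agree {x} i∉ j∉ = ⊆-antisym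
    (λ y∈ → case ∈-cycleThrough⁻ h y∈ of λ { (k , eq) → ∈-cycleThrough⁺ g (k , trans (sym (same k)) eq) })
    (λ y∈ → case ∈-cycleThrough⁻ g y∈ of λ { (k , eq) → ∈-cycleThrough⁺ h (k , trans (same k) eq) })
    where same = iterate-agree {x} (i∉ ∘ ∈-cycleThrough⁺ h) (j∉ ∘ ∈-cycleThrough⁺ h)

  -- A cycle of `h` avoiding both `i` and `j` is also a cycle of `g`, and it still avoids both
  -- points there. This sorts the cycles of `h` for the two counts that follow.
  cycles-swapped : ∀ {S} → S ∈ cycles h →
    S ≡ cycleThrough h i ⊎ S ≡ cycleThrough h j ⊎
    (S ∈ cycles g × S ≢ cycleThrough g i × S ≢ cycleThrough g j)
  cycles-swapped S∈ with ∈-cycles⁻ h S∈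
  ... | x , refl with i ∈? cycleThrough h x | j ∈? cycleThrough h x
  ...   | yes i∈ | _      = inj₁ (cycleThrough-≡ h i∈)
  ...   | no _   | yes j∈ = inj₂ (inj₁ (cycleThrough-≡ h j∈))
  ...   | no i∉  | no j∉  = inj₂ (inj₂
    ( subst (_∈ cycles g) (sym (cycleThrough-agree i∉ j∉)) (∈-cycles⁺ g x)
    , (λ eq → i∉ (subst (i ∈ˢ_) (sym eq) (cycleThrough-self g i)))
    , (λ eq → j∉ (subst (j ∈ˢ_) (sym eq) (cycleThrough-self g j)))))

  -- At most two cycles are new, and the cycle of `g` through `i` is lost. Only that one is
  -- deducted, because in `g` the point `j` may lie on the same cycle.
  cycleCount-swapped : cycleCount h ≤ suc (cycleCount g)
  cycleCount-swapped = ℕ.≤-trans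
    (unique-⊆⇒length-≤ _≟ˢ_ {ys = cycleThrough h i ∷ cycleThrough h j ∷ rest} (cycles-unique h) covered)
    (s≤s (length-without _≟ˢ_ (∈-cycles⁺ g i)))
    where
    rest = without _≟ˢ_ (cycleThrough g i) (cycles g)
    covered : cycles h ⊆ cycleThrough h i ∷ cycleThrough h j ∷ rest
    covered S∈ with cycles-swapped S∈
    ... | inj₁ eq                    = here eq
    ... | inj₂ (inj₁ eq)             = there (here eq)
    ... | inj₂ (inj₂ (S∈g , S≢ , _)) = there (there (∈-without _≟ˢ_ S∈g S≢))

  -- In `g` the fixed point `j` is a cycle of its own, apart from that of `i`. Since `h` sends `i`
  -- to `j`, one cycle of `h` replaces these two.
  cycleCount-swapped-fixed : i ≢ j → g ⟨$⟩ʳ j ≡ j → suc (cycleCount h) ≤ cycleCount g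
  cycleCount-swapped-fixed i≢j gj≡j = ℕ.≤-trans
    (s≤s (unique-⊆⇒length-≤ _≟ˢ_ {ys = cycleThrough h i ∷ rest′} (cycles-unique h) covered))
    (ℕ.≤-trans (s≤s (length-without _≟ˢ_ (∈-without _≟ˢ_ (∈-cycles⁺ g j) distinct)))
               (length-without _≟ˢ_ (∈-cycles⁺ g i)))
    where
    rest  = without _≟ˢ_ (cycleThrough g i) (cycles g)
    rest′ = without _≟ˢ_ (cycleThrough g j) rest

    distinct : cycleThrough g j ≢ cycleThrough g i
    distinct eq = i≢j (cycleThrough-fixed g gj≡j (subst (i ∈ˢ_) (sym eq) (cycleThrough-self g i)))

    merged : cycleThrough h i ≡ cycleThrough h j
    merged = cycleThrough-≡ h (∈-cycleThrough⁺ h (1 , trans at-i gj≡j))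

    covered : cycles h ⊆ cycleThrough h i ∷ rest′
    covered S∈ with cycles-swapped S∈
    ... | inj₁ eq                      = here eq
    ... | inj₂ (inj₁ eq)               = here (trans eq (sym merged))
    ... | inj₂ (inj₂ (S∈g , S≢i , S≢j)) = there (∈-without _≟ˢ_ (∈-without _≟ˢ_ S∈g S≢i) S≢j)

-- Sums that differ in few terms.

-- The crossed terms express the difference of the sums without truncated subtraction.
sum-agree-off : ∀ (i : Fin n) {φ ψ : Fin n → ℕ} → (∀ {x} → x ≢ i → φ x ≡ ψ x) →
                sum φ ℕ.+ ψ i ≡ sum ψ ℕ.+ φ i
sum-agree-off {suc n} zero {φ} {ψ} agree = trans
  (cong (λ s → φ zero ℕ.+ s ℕ.+ ψ zero) (sum-cong-≗ {n} (λ x → agree {suc x} (λ ()))))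
  (rearrange (φ zero) (ψ zero) (sum (ψ ∘ suc)))
  where
  rearrange : ∀ a b s → a ℕ.+ s ℕ.+ b ≡ b ℕ.+ s ℕ.+ a
  rearrange = ℕ-Solver.solve-∀
sum-agree-off {suc n} (suc i) {φ} {ψ} agree = begin
  φ zero ℕ.+ sum (φ ∘ suc) ℕ.+ ψ (suc i)    ≡⟨ ℕ.+-assoc (φ zero) _ _ ⟩
  φ zero ℕ.+ (sum (φ ∘ suc) ℕ.+ ψ (suc i))  ≡⟨ cong₂ ℕ._+_ (agree (λ ())) (sum-agree-off i (λ x≢i → agree (x≢i ∘ suc-injective))) ⟩
  ψ zero ℕ.+ (sum (ψ ∘ suc) ℕ.+ φ (suc i))  ≡⟨ ℕ.+-assoc (ψ zero) _ _ ⟨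
  ψ zero ℕ.+ sum (ψ ∘ suc) ℕ.+ φ (suc i)    ∎
  where open ≡-Reasoning

-- The function `χ`, equal to `ψ` at `i` and to `φ` elsewhere, interpolates between the two, so each
-- half changes a single index. As `i ≢ j`, `χ` still agrees with `φ` at `j`.
sum-agree-off₂ : ∀ {i j : Fin n} {φ ψ : Fin n → ℕ} → i ≢ j →
                 (∀ {x} → x ≢ i → x ≢ j → φ x ≡ ψ x) →
                 sum φ ℕ.+ (ψ i ℕ.+ ψ j) ≡ sum ψ ℕ.+ (φ i ℕ.+ φ j)
sum-agree-off₂ {n} {i} {j} {φ} {ψ} i≢j agree = ℕ.+-cancelʳ-≡ (sum χ) _ _ (begin
  sum φ ℕ.+ (ψ i ℕ.+ ψ j) ℕ.+ sum χ      ≡⟨ rearrange (sum φ) (ψ i) (ψ j) (sum χ) ⟩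
  (sum φ ℕ.+ ψ i) ℕ.+ (sum χ ℕ.+ ψ j)    ≡⟨ cong₂ ℕ._+_ φ∼χ χ∼ψ ⟩
  (sum χ ℕ.+ φ i) ℕ.+ (sum ψ ℕ.+ φ j)    ≡⟨ rearrange′ (sum χ) (φ i) (sum ψ) (φ j) ⟩
  sum ψ ℕ.+ (φ i ℕ.+ φ j) ℕ.+ sum χ      ∎)
  where
  open ≡-Reasoning
  χ : Fin n → ℕ
  χ = updateAt φ i (const (ψ i))
  χi : χ i ≡ ψ i
  χi = updateAt-updates i φ
  χ-other : ∀ {x} → x ≢ i → χ x ≡ φ x
  χ-other x≢i = updateAt-minimal _ i φ x≢i
  φ∼χ : sum φ ℕ.+ ψ i ≡ sum χ ℕ.+ φ i
  φ∼χ = subst (λ y → sum φ ℕ.+ y ≡ sum χ ℕ.+ φ i) χi (sum-agree-off i (sym ∘ χ-other))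
  χ≡ψ : ∀ {x} → x ≢ j → χ x ≡ ψ x
  χ≡ψ {x} x≢j with x ≟ i
  ... | yes refl = χi
  ... | no x≢i   = trans (χ-other x≢i) (agree x≢i x≢j)
  χ∼ψ : sum χ ℕ.+ ψ j ≡ sum ψ ℕ.+ φ j
  χ∼ψ = subst (λ y → sum χ ℕ.+ ψ j ≡ sum ψ ℕ.+ y) (χ-other (i≢j ∘ sym)) (sum-agree-off j χ≡ψ)
  rearrange : ∀ a b c d → a ℕ.+ (b ℕ.+ c) ℕ.+ d ≡ (a ℕ.+ b) ℕ.+ (d ℕ.+ c)
  rearrange = ℕ-Solver.solve-∀
  rearrange′ : ∀ a b c d → (a ℕ.+ b) ℕ.+ (c ℕ.+ d) ≡ c ℕ.+ (b ℕ.+ d) ℕ.+ a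
  rearrange′ = ℕ-Solver.solve-∀

-- Setting `φ` to 0 at the head splits the value there off the full sum and leaves the values on the
-- tail unchanged.
sum-unique-≤ : ∀ {xs : List (Fin n)} → Unique xs → ∀ φ → ListAction.sum (List.map φ xs) ≤ sum φ
sum-unique-≤ []                 φ = z≤n
sum-unique-≤ {n} {x ∷ xs} (x∉ ∷ uxs) φ = begin
  φ x ℕ.+ ListAction.sum (List.map φ xs)  ≡⟨ cong (λ ys → φ x ℕ.+ ListAction.sum ys) φ≡χ ⟩
  φ x ℕ.+ ListAction.sum (List.map χ xs)  ≤⟨ ℕ.+-monoʳ-≤ (φ x) (sum-unique-≤ uxs χ) ⟩
  φ x ℕ.+ sum χ                     ≡⟨ ℕ.+-comm (φ x) (sum χ) ⟩
  sum χ ℕ.+ φ x                     ≡⟨ sum-agree-off x (λ y≢x → sym (updateAt-minimal _ x φ y≢x)) ⟨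
  sum φ ℕ.+ χ x                     ≡⟨ cong (sum φ ℕ.+_) (updateAt-updates x φ) ⟩
  sum φ ℕ.+ 0                       ≡⟨ ℕ.+-identityʳ (sum φ) ⟩
  sum φ                             ∎
  where
  open ℕ.≤-Reasoning
  χ : Fin n → ℕ
  χ = updateAt φ x (const 0)
  φ≡χ : List.map φ xs ≡ List.map χ xs
  φ≡χ = map-cong-local (All.map (λ x≢y → sym (updateAt-minimal _ x φ (x≢y ∘ sym))) x∉)

-- Clearing the subtraction from the formula.

-- The formula is stated in the integers because `c - n` can be negative; the combinatorics uses the
-- form `n + d = c + s`.
shift-to-ℕ : ∀ d c n s → + d ≡ + c - + n + + s → n ℕ.+ d ≡ c ℕ.+ s
shift-to-ℕ d c n s eq = ℤ.+-injective (trans (cong (λ k → + n + k) eq) (cancel (+ n) (+ c) (+ s)))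
  where
  cancel : ∀ m b t → m + (b - m + t) ≡ b + t
  cancel = ℤ-Solver.solve-∀

shift-to-ℤ : ∀ d c n s → n ℕ.+ d ≡ c ℕ.+ s → + d ≡ + c - + n + + s
shift-to-ℤ d c n s eq = begin
  + d                ≡⟨ insert (+ n) (+ d) ⟩
  + n + + d - + n    ≡⟨ cong (λ k → + k - + n) eq ⟩
  + c + + s - + n    ≡⟨ reorder (+ c) (+ s) (+ n) ⟩
  + c - + n + + s    ∎
  where
  open ≡-Reasoning
  insert : ∀ m e → e ≡ m + e - m
  insert = ℤ-Solver.solve-∀
  reorder : ∀ b t m → b + t - m ≡ b - m + t
  reorder = ℤ-Solver.solve-∀

-- Walks in a graph.

module _ (G : Graph) where
  open Graph G

  walk-snoc : ∀ {u v w k} → Walk G u v k → Adj v w → Walk G u w (suc k)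
  walk-snoc (stop u≈v) e = step (proj₂ adj-resp (Setoid.sym vertices u≈v) e) (stop (Setoid.refl vertices))
  walk-snoc (step e′ w) e = step e′ (walk-snoc w e)

  walk-reverse : ∀ {u v k} → Walk G u v k → Walk G v u k
  walk-reverse (stop u≈v) = stop (Setoid.sym vertices u≈v)
  walk-reverse (step e w) = walk-snoc (walk-reverse w) (adj-sym e)

  walk-boundary : ∀ {P : Vertex → Set} → (∀ v → Dec (P v)) → P Respects _≈ᵛ_ →
                  ∀ {u v k} → Walk G u v k → P u → ¬ P v → ∃₂ λ x y → Adj x y × P x × ¬ P y
  walk-boundary P? resp (stop u≈v) pu ¬pv = contradiction (resp u≈v pu) ¬pv
  walk-boundary P? resp (step {v = w} e ws) pu ¬pv with P? w
  ... | yes pw = walk-boundary P? resp ws pw ¬pv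
  ... | no ¬pw = _ , _ , e , pu , ¬pw

-- Distances in the tree and in its Cayley graph.

module _ (T : Tree n) where
  open Tree T

  -- Supplies the missing edge between `a` and `c` in a path, and the independence of the leaves
  -- around a dominating vertex.
  no-triangle : ∀ {x y z} → Edge x y → Edge y z → ¬ Edge z x
  no-triangle {x} {y} {z} exy eyz ezx = acyclic c (inj , path , ezx)
    where
    c : Fin 3 → Fin n
    c zero             = x
    c (suc zero)       = y
    c (suc (suc zero)) = z
    path : ∀ i → Edge (c (inject₁ i)) (c (suc i))
    path zero       = exy
    path (suc zero) = eyz
    distinct : ∀ {u v} → Edge u v → u ≢ v
    distinct e u≡v = edge-irrefl u≡v e
    inj : Injective _≡_ _≡_ c
    inj {zero}             {zero}             _  = refl
    inj {zero}             {suc zero}         eq = contradiction eq (distinct exy)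
    inj {zero}             {suc (suc zero)}   eq = contradiction (sym eq) (distinct ezx)
    inj {suc zero}         {zero}             eq = contradiction (sym eq) (distinct exy)
    inj {suc zero}         {suc zero}         _  = refl
    inj {suc zero}         {suc (suc zero)}   eq = contradiction eq (distinct eyz)
    inj {suc (suc zero)}   {zero}             eq = contradiction eq (distinct ezx)
    inj {suc (suc zero)}   {suc zero}         eq = contradiction (sym eq) (distinct eyz)
    inj {suc (suc zero)}   {suc (suc zero)}   _  = refl

  dist-≤ : ∀ {x y k} → Walk graph x y k → dist x y ≤ k
  dist-≤ {x} {y} w = proj₂ (proj₂ (HasDistances.distance hasDistances x y)) _ w

  dist-walk : ∀ x y → Walk graph x y (dist x y)
  dist-walk x y = proj₁ (proj₂ (HasDistances.distance hasDistances x y))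

  dist-self : ∀ x → dist x x ≡ 0
  dist-self x = ℕ.n≤0⇒n≡0 (dist-≤ (stop refl))

  dist-≥1 : ∀ {x y} → x ≢ y → 1 ≤ dist x y
  dist-≥1 {x} {y} x≢y with dist x y | dist-walk x y
  ... | _ | stop x≡y = contradiction x≡y x≢y
  ... | _ | step _ _ = s≤s z≤n

  dist-≥2 : ∀ {x y} → x ≢ y → ¬ Edge x y → 2 ≤ dist x y
  dist-≥2 {x} {y} x≢y ¬e with dist x y | dist-walk x y
  ... | _ | stop x≡y          = contradiction x≡y x≢y
  ... | _ | step e (stop refl) = contradiction e ¬e
  ... | _ | step _ (step _ _)  = s≤s (s≤s z≤n)

  totalDist : Permutation′ n → ℕ
  totalDist π = ∑[ i < n ] dist i (π ⟨$⟩ʳ i)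

  cayleyDist-≤ : ∀ g h {k} → Walk (cayley T) g h k → cayleyDist T g h ≤ k
  cayleyDist-≤ g h w = proj₂ (proj₂ (HasDistances.distance (cayley-hasDistances T) g h)) _ w

  cayleyDist-walk : ∀ g h → Walk (cayley T) g h (cayleyDist T g h)
  cayleyDist-walk g h = proj₁ (proj₂ (HasDistances.distance (cayley-hasDistances T) g h))

  -- Trees that are not stars.

  Dominating : Fin n → Set
  Dominating c = ∀ x → c ≡ x ⊎ Edge c x

  near? : ∀ c x → Dec (c ≡ x ⊎ Edge c x)
  near? c x = (c ≟ x) ⊎-dec edge? c x

  -- A walk from `c` to a vertex outside its closed neighbourhood must leave that neighbourhood. The
  -- last vertex inside cannot be `c`, all of whose neighbours are inside, so it is a neighbour of
  -- `c`.
  two-step : ∀ {c} → ¬ Dominating c → ∃₂ λ x y → Edge c x × Edge x y × ¬ (c ≡ y ⊎ Edge c y)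
  two-step {c} ¬dom with ¬∀⟶∃¬ n _ (near? c) ¬dom
  ... | v , ¬near with walk-boundary graph (near? c) (λ { refl p → p }) (proj₂ (connected c v)) (inj₁ refl) ¬near
  ...   | x , y , exy , inj₁ refl , ¬near′ = contradiction (inj₂ exy) ¬near′
  ...   | x , y , exy , inj₂ ecx  , ¬near′ = x , y , ecx , exy , ¬near′

  -- The other facts about the induced path are derived: `a ≢ d` because `b` is adjacent to `a` but
  -- not to `d`, and `a`, `c` are not adjacent because a tree has no triangle.
  P₄ : Set
  P₄ = ∃₂ λ a b → ∃₂ λ c d → Edge a b × Edge b c × Edge c d × a ≢ c × ¬ (b ≡ d ⊎ Edge b d)

  -- Two steps from `r` pass through `b` to `s`, and two steps from `b` pass through `c` to `d`. The
  -- first vertex is `r`, unless `r` is `c`; then it is `s`, which differs from `r` by being outside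
  -- its closed neighbourhood.
  path-of-length-3 : (∀ c → ¬ Dominating c) → Fin n → P₄
  path-of-length-3 ¬dom r with two-step (¬dom r)
  ... | b , s , erb , ebs , ¬near-rs with two-step (¬dom b)
  ...   | c , d , ebc , ecd , ¬near-bd with r ≟ c
  ...     | yes refl = s , b , c , d , edge-sym ebs , ebc , ecd , ¬near-rs ∘ inj₁ ∘ sym , ¬near-bd
  ...     | no r≢c   = r , b , c , d , erb , ebc , ecd , r≢c , ¬near-bd

  P₄-defect : P₄ → ∃ λ π → n ℕ.+ cayleyDist T id π < cycleCount π ℕ.+ totalDist π
  P₄-defect (a , b , c , d , eab , ebc , ecd , a≢c , ¬near-bd) = π , (begin-strict
    n ℕ.+ cayleyDist T id π      ≤⟨ ℕ.+-monoʳ-≤ n (cayleyDist-≤ id π walk) ⟩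
    n ℕ.+ 4                      ≤⟨ ℕ.+-monoˡ-≤ 4 n≤ ⟩
    2 ℕ.+ cycleCount π ℕ.+ 4     <⟨ ℕ.n<1+n _ ⟩
    3 ℕ.+ cycleCount π ℕ.+ 4     ≤⟨ ℕ.n≤1+n _ ⟩
    4 ℕ.+ cycleCount π ℕ.+ 4     ≡⟨ rearrange (cycleCount π) ⟩
    cycleCount π ℕ.+ 8           ≤⟨ ℕ.+-monoʳ-≤ (cycleCount π) 8≤ ⟩
    cycleCount π ℕ.+ totalDist π ∎)
    where
    open ℕ.≤-Reasoning hiding (stop)
    b≢d : b ≢ d
    b≢d = ¬near-bd ∘ inj₁
    ¬ebd : ¬ Edge b d
    ¬ebd = ¬near-bd ∘ inj₂
    ¬eac : ¬ Edge a c
    ¬eac eac = no-triangle eab ebc (edge-sym eac)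
    distinct : ∀ {u v} → Edge u v → u ≢ v
    distinct e u≡v = edge-irrefl u≡v e
    a≢b = distinct eab
    b≢c = distinct ebc
    c≢d = distinct ecd
    a≢d : a ≢ d
    a≢d refl = ¬ebd (edge-sym eab)

    π₁ π : Permutation′ n
    π₁ = transpose b d
    -- The orientation `c a` is the one that `transpose-conjugate` yields in `word≈π`.
    π  = transpose c a ∘ₚ π₁

    πa : π ⟨$⟩ʳ a ≡ c
    πa = trans (cong (π₁ ⟨$⟩ʳ_) (transpose-right c a)) (transpose-other (b≢c ∘ sym) c≢d)
    πb : π ⟨$⟩ʳ b ≡ d
    πb = trans (cong (π₁ ⟨$⟩ʳ_) (transpose-other b≢c (a≢b ∘ sym))) (transpose-left b d)
    πc : π ⟨$⟩ʳ c ≡ a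
    πc = trans (cong (π₁ ⟨$⟩ʳ_) (transpose-left c a)) (transpose-other a≢b a≢d)
    πd : π ⟨$⟩ʳ d ≡ b
    πd = trans (cong (π₁ ⟨$⟩ʳ_) (transpose-other (c≢d ∘ sym) (a≢d ∘ sym))) (transpose-right b d)

    far : ∀ {x y} → π ⟨$⟩ʳ x ≡ y → x ≢ y → ¬ Edge x y → 2 ≤ dist x (π ⟨$⟩ʳ x)
    far refl = dist-≥2

    8≤ : 8 ≤ totalDist π
    8≤ = ℕ.≤-trans
      (ℕ.+-mono-≤ (far πa a≢c ¬eac) (ℕ.+-mono-≤ (far πb b≢d ¬ebd)
        (ℕ.+-mono-≤ (far πc (a≢c ∘ sym) (¬eac ∘ edge-sym))
          (ℕ.+-mono-≤ (far πd (b≢d ∘ sym) (¬ebd ∘ edge-sym)) z≤n))))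
      (sum-unique-≤ {xs = a ∷ b ∷ c ∷ d ∷ []}
        ((a≢b ∷ a≢c ∷ a≢d ∷ []) ∷ (b≢c ∷ b≢d ∷ []) ∷ (c≢d ∷ []) ∷ [] ∷ [])
        (λ i → dist i (π ⟨$⟩ʳ i)))

    n≤ : n ≤ 2 ℕ.+ cycleCount π
    -- Undoing the two transpositions leads back to `id`, and each creates at most one cycle.
    n≤ = begin
      n                       ≡⟨ cycleCount-id ⟨
      cycleCount (id {n})     ≤⟨ cycleCount-swapped (swapped-sym (transpose-swapped b d id)) ⟩
      suc (cycleCount π₁)     ≤⟨ s≤s (cycleCount-swapped (swapped-sym (transpose-swapped c a π₁))) ⟩
      2 ℕ.+ cycleCount π      ∎

    rearrange : ∀ k → 4 ℕ.+ k ℕ.+ 4 ≡ k ℕ.+ 8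
    rearrange = ℕ-Solver.solve-∀

    tba = transpose b a ⟨$⟩ʳ_
    tbc = transpose b c ⟨$⟩ʳ_
    tcb = transpose c b ⟨$⟩ʳ_
    tcd = transpose c d ⟨$⟩ʳ_

    word≈π : transpose c b ∘ₚ transpose b a ∘ₚ transpose c d ∘ₚ transpose b c ∘ₚ id ≈ π
    -- Inserting (c b)(b c) = I in the middle splits the word into two conjugates, (c b)(b a)(c b) =
    -- (c a) and (b c)(c d)(b c) = (b d).
    word≈π x = trans
      (cong (tbc ∘ tcd) (sym (transpose-inverse b c {tba (tcb x)})))
      (trans (transpose-conjugate b≢d b≢c c≢d (tcb (tba (tcb x))))
             (cong (π₁ ⟨$⟩ʳ_) (transpose-conjugate (a≢c ∘ sym) (b≢c ∘ sym) (a≢b ∘ sym) x)))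

    walk : Walk (cayley T) id π 4
    walk =
      step {v = transpose b c ∘ₚ id} (b , c , ebc , λ _ → refl) (
      step {v = transpose c d ∘ₚ transpose b c ∘ₚ id} (c , d , ecd , λ _ → refl) (
      step {v = transpose b a ∘ₚ transpose c d ∘ₚ transpose b c ∘ₚ id} (b , a , edge-sym eab , λ _ → refl) (
      step {v = transpose c b ∘ₚ transpose b a ∘ₚ transpose c d ∘ₚ transpose b c ∘ₚ id} (c , b , edge-sym ebc , λ _ → refl) (
      stop word≈π))))

  -- The distance formula on a star.

  IsStarAt : Fin n → Set
  IsStarAt c = (∀ {x} → x ≢ c → Edge c x) × (∀ {x y} → x ≢ c → y ≢ c → ¬ Edge x y)

  dominating⇒star : ∀ {c} → Dominating c → IsStarAt c
  dominating⇒star {c} dom = spoke , λ x≢c y≢c exy →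
    no-triangle (spoke x≢c) exy (edge-sym (spoke y≢c))
    where
    spoke : ∀ {x} → x ≢ c → Edge c x
    spoke {x} x≢c with dom x
    ... | inj₁ c≡x = contradiction (sym c≡x) x≢c
    ... | inj₂ e   = e

  module Star {c : Fin n} (star : IsStarAt c) where

    spoke : ∀ {x} → x ≢ c → Edge c x
    spoke = proj₁ star

    dist-center : ∀ {x} → x ≢ c → dist c x ≡ 1
    dist-center x≢c = ℕ.≤-antisym (dist-≤ (step (spoke x≢c) (stop refl))) (dist-≥1 (x≢c ∘ sym))

    -- For a leaf `j` this is `dist j x − dist c x + 1`, where the shift by one keeps the value
    -- natural.
    offset : Fin n → Fin n → ℕ
    offset j x with x ≟ j
    ... | yes _ = 0
    ... | no _  = 2

    offset-self : ∀ {j x} → x ≡ j → offset j x ≡ 0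
    offset-self {j} {x} x≡j with x ≟ j
    ... | yes _  = refl
    ... | no x≢j = contradiction x≡j x≢j

    offset-other : ∀ {j x} → x ≢ j → offset j x ≡ 2
    offset-other {j} {x} x≢j with x ≟ j
    ... | yes x≡j = contradiction x≡j x≢j
    ... | no _    = refl

    offset-≤2 : ∀ j x → offset j x ≤ 2
    offset-≤2 j x with x ≟ j
    ... | yes _ = z≤n
    ... | no _  = ℕ.≤-refl

    -- For `x` equal to `j`, to `c`, or to another leaf, the equation reads 0 + 1 = 1 + 0, 1 + 1 = 0
    -- + 2, or 2 + 1 = 1 + 2.
    dist-leaf : ∀ {j} → j ≢ c → ∀ x → dist j x ℕ.+ 1 ≡ dist c x ℕ.+ offset j x
    dist-leaf {j} j≢c x with x ≟ j | x ≟ c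
    ... | yes refl | _        rewrite dist-self x | dist-center j≢c = refl
    ... | no _     | yes refl rewrite dist-self x = cong (ℕ._+ 1)
      (ℕ.≤-antisym (dist-≤ (step (edge-sym (spoke j≢c)) (stop refl))) (dist-≥1 j≢c))
    ... | no x≢j   | no x≢c   rewrite dist-center x≢c = cong (ℕ._+ 1)
      (ℕ.≤-antisym (dist-≤ (step (edge-sym (spoke j≢c)) (step (spoke x≢c) (stop refl))))
                   (dist-≥2 (x≢j ∘ sym) (proj₂ star j≢c x≢c)))

    -- To be identified with `n` plus the distance from the identity, by showing that it starts at
    -- `n` and behaves like a distance along edges.
    potential : Permutation′ n → ℕ
    potential π = cycleCount π ℕ.+ totalDist π

    module _ {j : Fin n} (j≢c : j ≢ c) {g h : Permutation′ n} (sw : Swapped c j g h) where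

      open Swapped sw

      -- Only the terms at `c` and `j` change: they exchange their targets `g c` and `g j`.
      -- `dist-leaf` at each target measures the effect of moving its source, and the two shifts by
      -- one cancel.
      totalDist-swapped : totalDist h ℕ.+ offset j (g ⟨$⟩ʳ j) ≡ totalDist g ℕ.+ offset j (g ⟨$⟩ʳ c)
      totalDist-swapped = cancel (totalDist h) (totalDist g)
        (begin
          totalDist h ℕ.+ (dist c (g ⟨$⟩ʳ c) ℕ.+ dist j (g ⟨$⟩ʳ j))
            ≡⟨ sum-agree-off₂ (j≢c ∘ sym) (λ {x} x≢c x≢j → cong (dist x) (agree x≢c x≢j)) ⟩
          totalDist g ℕ.+ (dist c (h ⟨$⟩ʳ c) ℕ.+ dist j (h ⟨$⟩ʳ j))
            ≡⟨ cong₂ (λ x y → totalDist g ℕ.+ (dist c x ℕ.+ dist j y)) at-i at-j ⟩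
          totalDist g ℕ.+ (dist c (g ⟨$⟩ʳ j) ℕ.+ dist j (g ⟨$⟩ʳ c)) ∎)
        (dist-leaf j≢c (g ⟨$⟩ʳ j))
        (dist-leaf j≢c (g ⟨$⟩ʳ c))
        where
        open ≡-Reasoning
        cancel : ∀ s s′ {p q p′ q′ e e′} → s ℕ.+ (p ℕ.+ q) ≡ s′ ℕ.+ (p′ ℕ.+ q′) →
                 q ℕ.+ 1 ≡ p′ ℕ.+ e → q′ ℕ.+ 1 ≡ p ℕ.+ e′ → s ℕ.+ e ≡ s′ ℕ.+ e′
        -- Adding `p + p′` to both sides makes room for substituting the two leaf equations.
        cancel s s′ {p} {q} {p′} {q′} {e} {e′} total leaf leaf′ = ℕ.+-cancelʳ-≡ (p ℕ.+ p′) _ _ (begin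
          s ℕ.+ e ℕ.+ (p ℕ.+ p′)        ≡⟨ shuffle s e p p′ ⟩
          s ℕ.+ (p ℕ.+ (p′ ℕ.+ e))      ≡⟨ cong (λ y → s ℕ.+ (p ℕ.+ y)) leaf ⟨
          s ℕ.+ (p ℕ.+ (q ℕ.+ 1))       ≡⟨ shift s p q ⟩
          s ℕ.+ (p ℕ.+ q) ℕ.+ 1         ≡⟨ cong (ℕ._+ 1) total ⟩
          s′ ℕ.+ (p′ ℕ.+ q′) ℕ.+ 1      ≡⟨ shift s′ p′ q′ ⟨
          s′ ℕ.+ (p′ ℕ.+ (q′ ℕ.+ 1))    ≡⟨ cong (λ y → s′ ℕ.+ (p′ ℕ.+ y)) leaf′ ⟩
          s′ ℕ.+ (p′ ℕ.+ (p ℕ.+ e′))    ≡⟨ shuffle′ s′ p p′ e′ ⟩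
          s′ ℕ.+ e′ ℕ.+ (p ℕ.+ p′)      ∎)
          where
          shuffle : ∀ a b x y → a ℕ.+ b ℕ.+ (x ℕ.+ y) ≡ a ℕ.+ (x ℕ.+ (y ℕ.+ b))
          shuffle = ℕ-Solver.solve-∀
          shuffle′ : ∀ a x y b → a ℕ.+ (y ℕ.+ (x ℕ.+ b)) ≡ a ℕ.+ b ℕ.+ (x ℕ.+ y)
          shuffle′ = ℕ-Solver.solve-∀
          shift : ∀ a x y → a ℕ.+ (x ℕ.+ (y ℕ.+ 1)) ≡ a ℕ.+ (x ℕ.+ y) ℕ.+ 1
          shift = ℕ-Solver.solve-∀

      offsets⇒totalDist : ∀ {e e′} → offset j (g ⟨$⟩ʳ j) ≡ e → offset j (g ⟨$⟩ʳ c) ≡ e′ →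
                          totalDist h ℕ.+ e ≡ totalDist g ℕ.+ e′
      offsets⇒totalDist refl refl = totalDist-swapped

      -- If `g` fixes `j`, the distance sum rises by 2 but a cycle is lost. Otherwise the sum does
      -- not rise, and at most one cycle is gained.
      potential-swapped : potential h ≤ suc (potential g)
      potential-swapped with g ⟨$⟩ʳ j ≟ j
      ... | yes gj≡j = begin
        cycleCount h ℕ.+ totalDist h        ≡⟨ cong (cycleCount h ℕ.+_) h≡g+2 ⟩
        cycleCount h ℕ.+ (totalDist g ℕ.+ 2) ≡⟨ split (cycleCount h) (totalDist g) ⟩
        suc (suc (cycleCount h) ℕ.+ totalDist g)
          ≤⟨ s≤s (ℕ.+-monoˡ-≤ (totalDist g) (cycleCount-swapped-fixed sw (j≢c ∘ sym) gj≡j)) ⟩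
        suc (potential g)                    ∎
        where
        open ℕ.≤-Reasoning
        h≡g+2 : totalDist h ≡ totalDist g ℕ.+ 2
        h≡g+2 = trans (sym (ℕ.+-identityʳ _)) (offsets⇒totalDist (offset-self gj≡j)
          (offset-other λ gc≡j → j≢c (⟨$⟩ʳ-injective g (trans gj≡j (sym gc≡j)))))
        split : ∀ a b → a ℕ.+ (b ℕ.+ 2) ≡ suc (suc a ℕ.+ b)
        split = ℕ-Solver.solve-∀
      ... | no gj≢j = ℕ.+-mono-≤ (cycleCount-swapped sw) (ℕ.+-cancelʳ-≤ 2 _ _ (begin
        totalDist h ℕ.+ 2                       ≡⟨ offsets⇒totalDist (offset-other gj≢j) refl ⟩
        totalDist g ℕ.+ offset j (g ⟨$⟩ʳ c)     ≤⟨ ℕ.+-monoʳ-≤ (totalDist g) (offset-≤2 j _) ⟩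
        totalDist g ℕ.+ 2                       ∎))
        where open ℕ.≤-Reasoning

      -- The transposition brings `j` home, since `h j = g c = j`. The distance sum drops by 2,
      -- which outweighs the at most one cycle gained.
      potential-decreases-moving-center : g ⟨$⟩ʳ c ≡ j → suc (potential h) ≤ potential g
      potential-decreases-moving-center gc≡j = begin
        suc (cycleCount h ℕ.+ totalDist h)        ≤⟨ s≤s (ℕ.+-monoˡ-≤ (totalDist h) (cycleCount-swapped sw)) ⟩
        suc (suc (cycleCount g) ℕ.+ totalDist h)  ≡⟨ split (cycleCount g) (totalDist h) ⟩
        cycleCount g ℕ.+ (totalDist h ℕ.+ 2)      ≡⟨ cong (cycleCount g ℕ.+_) h+2≡g ⟩
        cycleCount g ℕ.+ totalDist g              ∎
        where
        open ℕ.≤-Reasoning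
        h+2≡g : totalDist h ℕ.+ 2 ≡ totalDist g
        h+2≡g = trans (offsets⇒totalDist
          (offset-other λ gj≡j → j≢c (⟨$⟩ʳ-injective g (trans gj≡j (sym gc≡j)))) (offset-self gc≡j))
          (ℕ.+-identityʳ _)
        split : ∀ a b → suc (suc a ℕ.+ b) ≡ a ℕ.+ (b ℕ.+ 2)
        split = ℕ-Solver.solve-∀

      -- Neither `g j` nor `g c` equals `j`, so the distance sum is unchanged, while the trivial
      -- cycle of `c` is merged into that of `j`.
      potential-decreases-fixing-center : g ⟨$⟩ʳ c ≡ c → g ⟨$⟩ʳ j ≢ j → suc (potential h) ≤ potential g
      potential-decreases-fixing-center gc≡c gj≢j = ℕ.+-mono-≤
        (cycleCount-swapped-fixed (swapped-comm sw) j≢c gc≡c)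
        (ℕ.≤-reflexive (ℕ.+-cancelʳ-≡ 2 _ _ (offsets⇒totalDist (offset-other gj≢j)
          (offset-other λ gc≡j → j≢c (trans (sym gc≡j) gc≡c)))))

    potential-cong : ∀ g h → g ≈ h → potential g ≡ potential h
    potential-cong g h g≈h = cong₂ ℕ._+_ (cycleCount-cong g h g≈h) (sum-cong-≗ (λ i → cong (dist i) (g≈h i)))

    potential-id : potential id ≡ n
    potential-id = trans (cong₂ ℕ._+_ cycleCount-id
      (trans (sum-cong-≗ dist-self) (sum-replicate-zero n))) (ℕ.+-identityʳ n)

    potential-adjacent : ∀ g h → Graph.Adj (cayley T) g h → potential h ≤ suc (potential g)
    potential-adjacent g h (i , j , e , h≈) with i ≟ c | j ≟ c
    ... | yes refl | _        = potential-swapped (λ j≡c → edge-irrefl (sym j≡c) e) (≈⇒swapped i j g h h≈)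
    ... | no i≢c   | yes refl = potential-swapped i≢c (swapped-comm (≈⇒swapped i j g h h≈))
    ... | no i≢c   | no j≢c   = contradiction e (proj₂ star i≢c j≢c)

    potential-walk : ∀ {g h k} → Walk (cayley T) g h k → potential h ≤ k ℕ.+ potential g
    potential-walk {g} {h} (stop g≈h) = ℕ.≤-reflexive (sym (potential-cong g h g≈h))
    potential-walk {g} {k = suc k} (step {v = h} e w) = ℕ.≤-trans (potential-walk w)
      (ℕ.≤-trans (ℕ.+-monoʳ-≤ k (potential-adjacent g h e)) (ℕ.≤-reflexive (ℕ.+-suc k (potential g))))

    descend : ∀ π → ¬ (∀ x → π ⟨$⟩ʳ x ≡ x) →
              ∃ λ h → Graph.Adj (cayley T) π h × suc (potential h) ≤ potential π
    descend π π≉id with π ⟨$⟩ʳ c ≟ c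
    ... | no πc≢c  = transpose c (π ⟨$⟩ʳ c) ∘ₚ π , (c , _ , spoke πc≢c , λ _ → refl)
      , potential-decreases-moving-center πc≢c (transpose-swapped c _ π) refl
    ... | yes πc≡c with ¬∀⟶∃¬ n _ (λ x → π ⟨$⟩ʳ x ≟ x) π≉id
    ...   | j , πj≢j = transpose c j ∘ₚ π , (c , j , spoke j≢c , λ _ → refl)
      , potential-decreases-fixing-center j≢c (transpose-swapped c j π) πc≡c πj≢j
      where
      j≢c : j ≢ c
      j≢c refl = πj≢j πc≡c

    -- Greedy descent: every step lowers the potential by at least one. The bound `m` on the
    -- potential makes the recursion structural.
    descent : ∀ m π → potential π ≤ m → ∃ λ k → Walk (cayley T) π id k × n ℕ.+ k ≤ potential π
    descent m π ≤m with all? (λ x → π ⟨$⟩ʳ x ≟ x)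
    descent m π ≤m | yes π≈id = 0 , stop π≈id , ℕ.≤-reflexive
      (trans (ℕ.+-identityʳ n) (sym (trans (potential-cong π id π≈id) potential-id)))
    descent m π ≤m | no π≉id with descend π π≉id
    descent zero    π ≤m | no _ | h , _ , <π with () ← ℕ.≤-trans <π ≤m
    descent (suc m) π ≤m | no _ | h , e , <π with descent m h (ℕ.≤-pred (ℕ.≤-trans <π ≤m))
    ... | k , w , n+k≤ = suc k , step e w
      , ℕ.≤-trans (ℕ.≤-reflexive (ℕ.+-suc n k)) (ℕ.≤-trans (s≤s n+k≤) <π)

    -- The descending walk from `π`, reversed, bounds the distance from above. From below, a walk
    -- starting at `id` begins at potential `n` and gains at most one per step.
    distance-formula : ∀ π → n ℕ.+ cayleyDist T id π ≡ potential π
    distance-formula π with descent (potential π) π ℕ.≤-refl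
    ... | k , w , n+k≤ = ℕ.≤-antisym
      (ℕ.≤-trans (ℕ.+-monoʳ-≤ n (cayleyDist-≤ id π (walk-reverse (cayley T) w))) n+k≤)
      (ℕ.≤-trans (potential-walk (cayleyDist-walk id π))
        (ℕ.≤-reflexive (trans (cong (cayleyDist T id π ℕ.+_) potential-id) (ℕ.+-comm _ n))))

-- Stars as complete bipartite graphs.

isStarAt⇒≅ : ∀ {n} (T : Tree (suc n)) {c} → IsStarAt T c → Tree.graph T ≅ completeBipartite 1 n
isStarAt⇒≅ {n} T {c} (spoke , no-rim) = record
  { bijection = record
    { to        = to
    ; from      = from
    ; to-cong   = λ { refl → refl }
    ; from-cong = λ { refl → refl }
    ; inverse   = (λ { refl → to∘from _ }) , (λ { refl → from∘to _ })
    }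
  ; adj⇔adj   = λ u v → mk⇔ (adj⇒ u v) (adj⇐ u v)
  }
  where
  open Tree T using (Edge; edge-sym; edge-irrefl)

  -- The leaves are renumbered by skipping `c`, through `punchOut` and its inverse `punchIn`.
  to : Fin (suc n) → Fin 1 ⊎ Fin n
  to x with c ≟ x
  ... | yes _  = inj₁ zero
  ... | no c≢x = inj₂ (punchOut c≢x)

  from : Fin 1 ⊎ Fin n → Fin (suc n)
  from (inj₁ _) = c
  from (inj₂ k) = punchIn c k

  to∘from : ∀ y → to (from y) ≡ y
  to∘from (inj₁ zero) with c ≟ c
  ... | yes _  = refl
  ... | no c≢c = contradiction refl c≢c
  to∘from (inj₂ k) with c ≟ punchIn c k
  ... | yes eq = contradiction (sym eq) (punchInᵢ≢i c k)
  ... | no c≢  = cong inj₂ (trans (punchOut-cong c refl) (punchOut-punchIn c))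

  from∘to : ∀ x → from (to x) ≡ x
  from∘to x with c ≟ x
  ... | yes c≡x = c≡x
  ... | no c≢x  = punchIn-punchOut c≢x

  adj⇒ : ∀ u v → Edge u v → Graph.Adj (completeBipartite 1 n) (to u) (to v)
  adj⇒ u v e with c ≟ u | c ≟ v
  ... | yes refl | yes refl = edge-irrefl refl e
  ... | yes _    | no _     = tt
  ... | no _     | yes _    = tt
  ... | no c≢u   | no c≢v   = no-rim (c≢u ∘ sym) (c≢v ∘ sym) e

  adj⇐ : ∀ u v → Graph.Adj (completeBipartite 1 n) (to u) (to v) → Edge u v
  adj⇐ u v a with c ≟ u | c ≟ v
  adj⇐ u v () | yes _    | yes _
  adj⇐ u v a  | yes refl | no c≢v   = spoke (c≢v ∘ sym)
  adj⇐ u v a  | no c≢u   | yes refl = edge-sym (spoke (c≢u ∘ sym))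
  adj⇐ u v () | no _     | no _

≅⇒isStarAt : ∀ {m} (T : Tree n) → Tree.graph T ≅ completeBipartite 1 m → ∃ (IsStarAt T)
≅⇒isStarAt {n} {m} T iso = c , spoke , no-rim
  where
  open Tree T using (Edge)
  open _≅_ iso using (bijection; adj⇔adj; to)
  open Inverse bijection using (from; strictlyInverseˡ; strictlyInverseʳ)

  c : Fin n
  c = from (inj₁ zero)

  to-leaf : ∀ {x} → x ≢ c → ∃ λ k → to x ≡ inj₂ k
  to-leaf {x} x≢c with to x in eq
  ... | inj₁ zero = contradiction (trans (sym (strictlyInverseʳ x)) (cong from eq)) x≢c
  ... | inj₂ k    = k , refl

  spoke : ∀ {x} → x ≢ c → Edge c x
  spoke {x} x≢c with to-leaf x≢c
  ... | k , eq = Equivalence.from (adj⇔adj c x)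
    (subst₂ (Graph.Adj (completeBipartite 1 m)) (sym (strictlyInverseˡ (inj₁ zero))) (sym eq) tt)

  no-rim : ∀ {x y} → x ≢ c → y ≢ c → ¬ Edge x y
  no-rim {x} {y} x≢c y≢c e with to-leaf x≢c | to-leaf y≢c
  ... | _ , eqx | _ , eqy =
    subst₂ (Graph.Adj (completeBipartite 1 m)) eqx eqy (Equivalence.to (adj⇔adj x y) e)

theorem5 : ∀ (n : ℕ) → 5 ≤ n → (T : Tree n) →
    (∀ (π : Permutation′ n) →
    + cayleyDist T id π ≡ + cycleCount π - + n + + (∑[ i < n ] Tree.dist T i (π ⟨$⟩ʳ i)))
    ⇔ (Tree.graph T ≅ completeBipartite 1 (n ∸ 1))
-- Matching on `suc n` reduces `n ∸ 1` and provides the vertex `zero` from which the path search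
-- starts.
theorem5 (suc n) _ T = mk⇔ formula⇒star star⇒formula
  where
  Formula : Set
  Formula = ∀ π → + cayleyDist T id π ≡ + cycleCount π - + suc n + + totalDist T π

  no-P₄ : Formula → ¬ P₄ T
  no-P₄ formula path = case P₄-defect T path of λ { (π , defect) →
    ℕ.<⇒≢ defect (shift-to-ℕ (cayleyDist T id π) (cycleCount π) (suc n) (totalDist T π) (formula π)) }

  formula⇒star : Formula → Tree.graph T ≅ completeBipartite 1 n
  -- Domination is decidable on finitely many vertices, so the case split is constructive.
  formula⇒star formula = case any? (λ c → all? (near? T c)) of λ
    { (yes (_ , dom)) → isStarAt⇒≅ T (dominating⇒star T dom)
    ; (no ¬dom)       → contradiction (path-of-length-3 T (λ c dom → ¬dom (c , dom)) zero) (no-P₄ formula)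
    }

  star⇒formula : Tree.graph T ≅ completeBipartite 1 n → Formula
  star⇒formula iso π = case ≅⇒isStarAt T iso of λ { (_ , star) →
    shift-to-ℤ (cayleyDist T id π) (cycleCount π) (suc n) (totalDist T π)
      (Star.distance-formula T star π) }
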